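{- Let $n\ge 1$ and $N\ge 3$ be integers, and let $C_N^n$ be the $n$-th power of the cycle $C_N$ on $N$ vertices. Let $r\in\{0,1,\ldots,2n+1\}$ be the remainder of $N$ modulo $2n+2$. Then $$\gamma_{Zg}(C_N^n)=\begin{cases}\left\lceil\frac{N}{n+1}\right\rceil, & r\in\{0,1,\ldots,n+1\},\\[4pt] \left\lceil\frac{N}{n+1}\right\rceil-1, & r\in\{n+2,\ldots,2n+1\}.\end{cases}$$
   Context: $N(v)$ and $N[v]=N(v)\cup\{v\}$ denote the open and closed neighborhood of a vertex $v$. The $n$-th power $C_N^n$ of the cycle $C_N$ has the same vertex set as $C_N$, and two distinct vertices are adjacent in $C_N^n$ if and only if their distance in $C_N$ is at most $n$. Z-domination game: two players, Dominator and Staller, alternately select vertices $v_1,v_2,\ldots$ of an isolate-free graph $G$. The $i$-th move $v_i$ is legal if $N(v_i)\setminus\bigcup_{j=1}^{i-1}N[v_j]\neq\emptyset$. The game ends when no legal move is available. Dominator wants to minimize the total number of moves, Staller wants to maximize it. $\gamma_{Zg}(G)$ is the total number of moves played (by both players) when Dominator moves first and both players play optimally. -}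

module Defs where

open import Data.Fin using (Fin; toℕ)
open import Data.Fin.Properties using (any?; toℕ<n) renaming (_≟_ to _≟ᶠ_)
open import Data.Fin.Subset using (Subset; _∈_; _∉_; _∪_; _─_; ⁅_⁆; ∁; ⋃; Nonempty; ∣_∣)
open import Data.Fin.Subset.Properties
  using (nonempty?; p⊂q⇒∣p∣<∣q∣; p⊂q⇒∁p⊃∁q; p⊆p∪q; q⊆p∪q; p─q⊆p)
open import Data.List using (List; []; _∷_; map; mapMaybe; allFin)
open import Data.List.Extrema.Nat using (min; max)
import Data.Maybe as Maybe
open import Data.Nat using (ℕ; zero; suc; _≤_; _<_; _%_; s≤s; s≤s⁻¹; z≤n; NonZero; >-nonZero)
open import Data.Nat.DivMod using (m<n⇒m%n≡m; n%n≡0)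
open import Data.Nat.Induction using (Acc; acc; <-wellFounded)
open import Data.Nat.Properties
  using (_≟_; anyUpTo?; allUpTo?; m≤n⇒m<n∨m≡n; ≤-trans; <-irrefl; 1+n≢n)
open import Data.Product using (∃; _×_; _,_)
open import Data.Sum using (_⊎_; inj₁; inj₂; swap; [_,_]′)
open import Data.Vec using (tabulate; []; _∷_; there)
open import Function using (_∘_)
open import Level using (0ℓ)
open import Relation.Binary using (Rel; Decidable; Symmetric)
open import Relation.Binary.PropositionalEquality using (_≡_; _≢_; refl; sym; trans; cong)
open import Relation.Nullary using (¬_; Dec; does; yes; no)
open import Relation.Nullary.Decidable using (map′; _×-dec_; _⊎-dec_; ¬?; dec⇒maybe)

record Graph : Set₁ where
  field
    order      : ℕ
    Adj        : Rel (Fin order) 0ℓ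
    adj?       : Decidable Adj
    adj-sym    : Symmetric Adj
    adj-irrefl : ∀ {v} → ¬ Adj v v

  Vertex : Set
  Vertex = Fin order

module Distance (G : Graph) where
  open Graph G

  data Walk : ℕ → Vertex → Vertex → Set where
    []  : ∀ {u} → Walk zero u u
    _∷_ : ∀ {k u v w} → Adj u v → Walk k v w → Walk (suc k) u w

  IsDistance : Vertex → Vertex → ℕ → Set
  IsDistance u v d = Walk d u v × (∀ {k} → k < d → ¬ Walk k u v)

  walk? : ∀ k u v → Dec (Walk k u v)
  walk? zero    u v = map′ (λ { refl → [] }) (λ { [] → refl }) (u ≟ᶠ v)
  walk? (suc k) u v =
    map′ (λ (_ , a , p) → a ∷ p) (λ { (a ∷ p) → _ , a , p })
         (any? λ w → adj? u w ×-dec walk? k w v)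

  isDistance? : ∀ u v d → Dec (IsDistance u v d)
  isDistance? u v d = walk? d u v ×-dec allUpTo? (λ k → ¬? (walk? k u v)) d

  snoc : ∀ {k u v w} → Walk k u v → Adj v w → Walk (suc k) u w
  snoc []      b = b ∷ []
  snoc (a ∷ p) b = a ∷ snoc p b

  reverse : ∀ {k u v} → Walk k u v → Walk k v u
  reverse []      = []
  reverse (a ∷ p) = snoc (reverse p) (adj-sym a)

  isDistance-sym : ∀ {u v d} → IsDistance u v d → IsDistance v u d
  isDistance-sym (p , shortest) = reverse p , λ k<d q → shortest k<d (reverse q)

power : ℕ → Graph → Graph
power n G = record
  { order      = order
  ; Adj        = λ u v → u ≢ v × ∃ λ d → d ≤ n × IsDistance u v d
  ; adj?       = λ u v → ¬? (u ≟ᶠ v) ×-dec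
                   map′ (λ (d , d<1+n , p) → d , s≤s⁻¹ d<1+n , p)
                        (λ (d , d≤n , p) → d , s≤s d≤n , p)
                        (anyUpTo? (isDistance? u v) (suc n))
  ; adj-sym    = λ (u≢v , d , d≤n , p) → u≢v ∘ sym , d , d≤n , isDistance-sym p
  ; adj-irrefl = λ (v≢v , _) → v≢v refl
  }
  where
  open Graph G
  open Distance G

Succ : (N : ℕ) .{{_ : NonZero N}} → Rel (Fin N) 0ℓ
Succ N i j = toℕ j ≡ suc (toℕ i) % N

succ-irrefl : ∀ N .{{_ : NonZero N}} → 2 ≤ N → ∀ {i} → ¬ Succ N i i
succ-irrefl N 2≤N {i} i≡1+i%N with m≤n⇒m<n∨m≡n (toℕ<n i)
... | inj₁ 1+i<N = 1+n≢n (sym (trans i≡1+i%N (m<n⇒m%n≡m 1+i<N)))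
... | inj₂ 1+i≡N = <-irrefl (trans (sym (cong suc i≡0)) 1+i≡N) 2≤N
  where
  i≡0 : toℕ i ≡ 0
  i≡0 = trans i≡1+i%N (trans (cong (_% N) 1+i≡N) (n%n≡0 N))

cycle : (N : ℕ) → 3 ≤ N → Graph
cycle N 3≤N = record
  { order      = N
  ; Adj        = λ i j → Succ N i j ⊎ Succ N j i
  ; adj?       = λ i j → (toℕ j ≟ suc (toℕ i) % N) ⊎-dec (toℕ i ≟ suc (toℕ j) % N)
  ; adj-sym    = swap
  ; adj-irrefl = [ succ-irrefl N 2≤N , succ-irrefl N 2≤N ]′
  }
  where
  2≤N : 2 ≤ N
  2≤N = ≤-trans (s≤s (s≤s z≤n)) 3≤N
  instance
    N≢0 : NonZero N
    N≢0 = >-nonZero (≤-trans (s≤s z≤n) 3≤N)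

data Player : Set where
  dominator staller : Player

opponent : Player → Player
opponent dominator = staller
opponent staller   = dominator

-- The number of moves still to be played, given the numbers of moves that
-- would follow each of the player's legal moves; no legal move ends the game.
optimal : Player → List ℕ → ℕ
optimal _         []       = 0
optimal dominator (k ∷ ks) = suc (min k ks)
optimal staller   (k ∷ ks) = suc (max k ks)

x∈p─q⇒x∉q : ∀ {n} (p q : Subset n) {x} → x ∈ p ─ q → x ∉ q
x∈p─q⇒x∉q (_ ∷ p) (_ ∷ q) (there x∈p─q) (there x∈q) = x∈p─q⇒x∉q p q x∈p─q x∈q

module ZDomination (G : Graph) where
  open Graph G

  N : Vertex → Subset order
  N v = tabulate λ u → does (adj? v u)

  N[_] : Vertex → Subset order
  N[ v ] = N v ∪ ⁅ v ⁆

  -- A position is the list of vertices selected so far, by either player,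
  -- most recent first.
  Position : Set
  Position = List Vertex

  dominated : Position → Subset order
  dominated h = ⋃ (map N[_] h)

  Legal : Position → Vertex → Set
  Legal h v = Nonempty (N v ─ dominated h)

  legalMoves : (h : Position) → List (∃ (Legal h))
  legalMoves h =
    mapMaybe (λ v → Maybe.map (v ,_) (dec⇒maybe (nonempty? (N v ─ dominated h))))
             (allFin order)

  undominated : Position → ℕ
  undominated h = ∣ ∁ (dominated h) ∣

  legal-decreases : ∀ h v → Legal h v → undominated (v ∷ h) < undominated h
  legal-decreases h v (x , x∈) = p⊂q⇒∣p∣<∣q∣ (p⊂q⇒∁p⊃∁q
    ( q⊆p∪q N[ v ] (dominated h)
    , x
    , p⊆p∪q (dominated h) (p⊆p∪q ⁅ v ⁆ (p─q⊆p (N v) (dominated h) x∈))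
    , x∈p─q⇒x∉q (N v) (dominated h) x∈
    ))

  -- The accessibility argument only serves termination.
  movesLeft : Player → (h : Position) → Acc _<_ (undominated h) → ℕ
  movesLeft p h (acc rs) =
    optimal p (map (λ (v , legal) → movesLeft (opponent p) (v ∷ h) (rs (legal-decreases h v legal)))
                   (legalMoves h))

γZg : Graph → ℕ
γZg G = movesLeft dominator [] (<-wellFounded _)
  where open ZDomination G

{-# OPTIONS --safe #-}

-- A move newly dominates at most 2n + 1 vertices, and as soon as something is
-- dominated Staller can dominate just one: if w + n is dominated by w and
-- w + n + 1 is undominated, she plays w + 1.  So fewer than N vertices are
-- dominated after k moves as long as ⌈k/2⌉ (2n + 1) + ⌊k/2⌋ < N.
--
-- For the matching upper bound let N ≥ 2n + 2, since otherwise one move ends the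
-- game, and let Φ be the number of undominated vertices plus 2n times the number
-- of maximal runs of them.  A run is counted by its first vertex, so that there
-- is none while nothing is dominated, and Φ is N initially.  A legal move that
-- creates a run dominates 2n + 1 new vertices, so every legal move lowers Φ by
-- at least 1.  Playing i + n at the first vertex i of a run lowers Φ by at least
-- 2n + 1, because either all of i, …, i + 2n are new or the number of runs drops.
-- A position with some but not all vertices dominated has Φ ≥ 2n + 1, so both
-- bounds give the same number of moves.
module Submission where

open import Defs
open import Data.Bool using (Bool; true; false; not)
open import Data.Fin using (Fin; toℕ; fromℕ<)
open import Data.Fin.Properties using (toℕ<n; toℕ-fromℕ<; toℕ-injective; any?) renaming (_≟_ to _≟ᶠ_)
open import Data.Fin.Subset using (_∈_; _∉_; _─_; ⁅_⁆)
open import Data.Fin.Subset.Properties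
  using (nonempty?; _∈?_; ∉⊥; x∈⁅x⁆; x∈⁅y⁆⇒x≡y; x∈p∪q⁻; x∈p∪q⁺; p─q⊆p; x∈p∧x∉q⇒x∈p─q)
open import Data.List using ([]; _∷_)
open import Data.List.Extrema.Nat using (min≤v⁺; v≤min⁺; max≤v⁺; v≤max⁺)
open import Data.List.Membership.Propositional.Properties using (∈-allFin)
open import Data.List.Relation.Unary.All as All using (All; []; _∷_)
import Data.List.Relation.Unary.All.Properties as All
open import Data.List.Relation.Unary.Any as Any using (Any; here; there)
import Data.List.Relation.Unary.Any.Properties as Any
import Data.Maybe as Maybe
import Data.Maybe.Relation.Unary.Any as MAny
open import Data.Nat hiding (_/_)
import Data.Nat as ℕ
open import Data.Nat.DivMod
  using (m%n<n; m<n⇒m%n≡m; m%n%n≡m%n; m≡m%n+[m/n]*n; [m+n]%n≡m%n; [m+kn]%n≡m%n; %-distribˡ-+)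
open import Data.Nat.Induction using (Acc; acc; <-wellFounded)
open import Data.Nat.Properties
open import Data.Product using (∃; _×_; _,_; proj₁; proj₂)
open import Data.Sum using (_⊎_; inj₁; inj₂)
open import Data.Unit using (⊤)
open import Data.Vec using (lookup; tabulate)
open import Data.Vec.Properties using ([]=⇒lookup; lookup⇒[]=; lookup∘tabulate)
open import Function using (_∘_)
open import Relation.Binary.PropositionalEquality
open import Relation.Nullary using (¬_; Dec; yes; no; does; contradiction)
open import Relation.Nullary.Decidable using (dec⇒maybe; dec-true; ¬?)

-- Finite sums over initial segments of the naturals.

∑ : ℕ → (ℕ → ℕ) → ℕ
∑ zero    f = 0
∑ (suc L) f = ∑ L f + f L

∑-cong : ∀ L {f g} → (∀ k → k < L → f k ≡ g k) → ∑ L f ≡ ∑ L g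
∑-cong zero    eq = refl
∑-cong (suc L) eq = cong₂ _+_ (∑-cong L (λ k k<L → eq k (m<n⇒m<1+n k<L))) (eq L ≤-refl)

∑-mono : ∀ L {f g} → (∀ k → k < L → f k ≤ g k) → ∑ L f ≤ ∑ L g
∑-mono zero    le = z≤n
∑-mono (suc L) le = +-mono-≤ (∑-mono L (λ k k<L → le k (m<n⇒m<1+n k<L))) (le L ≤-refl)

∑-const : ∀ L c → ∑ L (λ _ → c) ≡ L * c
∑-const zero    c = refl
∑-const (suc L) c = trans (cong (_+ c) (∑-const L c)) (+-comm (L * c) c)

∑-++ : ∀ a b f → ∑ (a + b) f ≡ ∑ a f + ∑ b (λ k → f (a + k))
∑-++ a zero    f = trans (cong (λ z → ∑ z f) (+-identityʳ a)) (sym (+-identityʳ _))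
∑-++ a (suc b) f rewrite +-suc a b | ∑-++ a b f = +-assoc (∑ a f) _ _

term≤∑ : ∀ {L k} f → k < L → f k ≤ ∑ L f
term≤∑ {suc L} {k} f k<1+L with m≤n⇒m<n∨m≡n (s≤s⁻¹ k<1+L)
... | inj₁ k<L  = m≤n⇒m≤n+o (f L) (term≤∑ f k<L)
... | inj₂ refl = m≤n+m (f L) (∑ L f)

0<∑⇒∃ : ∀ L f → 0 < ∑ L f → ∃ λ k → 0 < f k
0<∑⇒∃ (suc L) f 0<∑ with f L in fL
... | suc _ = L , subst (0 <_) (sym fL) z<s
... | zero  = 0<∑⇒∃ L f (subst (0 <_) (+-identityʳ _) 0<∑)

-- Shifting by one trades `f 0` for `f N`, which agree by periodicity. Hence any window of the cycle
-- can be placed at the start of the sum.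
∑-rotate : ∀ N f → (∀ k → f (N + k) ≡ f k) → ∀ a → ∑ N (λ k → f (k + a)) ≡ ∑ N f
∑-rotate N f periodic zero    = ∑-cong N (λ k _ → cong f (+-identityʳ k))
∑-rotate N f periodic (suc a) = begin
  ∑ N (λ k → f (k + suc a))  ≡⟨ ∑-cong N (λ k _ → cong f (+-suc k a)) ⟩
  ∑ N (λ k → f (suc k + a))  ≡⟨ ∑-rotate N (f ∘ suc) periodic′ a ⟩
  ∑ N (f ∘ suc)              ≡⟨ +-cancelˡ-≡ (f 0) _ _ (begin
    f 0 + ∑ N (f ∘ suc)        ≡⟨ ∑-++ 1 N f ⟨
    ∑ N f + f N                ≡⟨ cong (λ z → ∑ N f + f z) (+-identityʳ N) ⟨
    ∑ N f + f (N + 0)          ≡⟨ cong (∑ N f +_) (periodic 0) ⟩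
    ∑ N f + f 0                ≡⟨ +-comm (∑ N f) (f 0) ⟩
    f 0 + ∑ N f                ∎) ⟩
  ∑ N f                      ∎
  where
  open ≡-Reasoning
  periodic′ : ∀ k → f (suc (N + k)) ≡ f (suc k)
  periodic′ k = trans (cong f (sym (+-suc N k))) (periodic (suc k))

⟦_⟧ : Bool → ℕ
⟦ false ⟧ = 0
⟦ true  ⟧ = 1

-- The potential on Boolean sequences, `true` meaning undominated.

module Weight (n : ℕ) where

  m : ℕ
  m = suc (2 * n)

  -- The first vertex of a run carries the 2n charged for that run.
  weight : Bool → Bool → ℕ
  weight _     false = 0
  weight true  true  = 1
  weight false true  = m

  φ : (ℕ → Bool) → ℕ → ℕ
  φ X k = weight (X k) (X (suc k))

  true⇒1≤φ : ∀ X k → X (suc k) ≡ true → 1 ≤ φ X k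
  true⇒1≤φ X k h with X k
  ... | true  rewrite h = ≤-refl
  ... | false rewrite h = s≤s z≤n

  -- Reading back from `L`, either all `L` terms contribute 1 each, or a `false` is met first and
  -- the term there is already `m`, which is at least `L`.
  L≤∑φ : ∀ X L → L ≤ m → X L ≡ true → L ≤ ∑ L (φ X)
  L≤∑φ X zero    L≤m h = z≤n
  L≤∑φ X (suc L) L≤m h with X L in eq
  ... | false rewrite h = m≤n⇒m≤o+n (∑ L (φ X)) L≤m
  ... | true  rewrite h | +-comm (∑ L (φ X)) 1 = s≤s (L≤∑φ X L (<⇒≤ L≤m) eq)

  -- Once indices 1 to `m` are dominated, an undominated index `suc m` starts a run of weight `m`.
  -- If it continued a run from index `m`, the earlier terms pay `m` by `L≤∑φ` and its own old term
  -- pays 1; if it was a run start already, the undominated `suc k` pays the 1.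
  1+next≤∑φ : ∀ X k → k < m → X (suc k) ≡ true → 1 + weight false (X (suc m)) ≤ ∑ (suc m) (φ X)
  1+next≤∑φ X k k<m h = go _ _ refl refl
    where
    open ≤-Reasoning
    1≤∑ : 1 ≤ ∑ m (φ X)
    1≤∑ = ≤-trans (true⇒1≤φ X k h) (term≤∑ (φ X) k<m)
    go : ∀ b c → X m ≡ b → X (suc m) ≡ c → 1 + weight false c ≤ ∑ (suc m) (φ X)
    go _ false _ _ = m≤n⇒m≤n+o (φ X m) 1≤∑
    go true true hb hc = begin
      suc m            ≡⟨ +-comm 1 m ⟩
      m + 1            ≤⟨ +-monoˡ-≤ 1 (L≤∑φ X m ≤-refl hb) ⟩
      ∑ m (φ X) + 1    ≡⟨ cong (∑ m (φ X) +_) (cong₂ weight hb hc) ⟨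
      ∑ (suc m) (φ X)  ∎
    go false true hb hc = begin
      suc m            ≤⟨ +-monoˡ-≤ m 1≤∑ ⟩
      ∑ m (φ X) + m    ≡⟨ cong (∑ m (φ X) +_) (cong₂ weight hb hc) ⟨
      ∑ (suc m) (φ X)  ∎

  -- The run starting at index 1 pays `m`. If index `suc m` becomes a run start, the `m` terms after
  -- the first pay for it by `L≤∑φ`.
  m+next≤∑φ : ∀ X → X 0 ≡ false → X 1 ≡ true → m + weight false (X (suc m)) ≤ ∑ (suc m) (φ X)
  m+next≤∑φ X h₀ h₁ = subst (m + weight false (X (suc m)) ≤_) (sym (∑-++ 1 m (φ X)))
    (+-mono-≤ (≤-reflexive φ0) (next _ refl))
    where
    φ0 : m ≡ φ X 0
    φ0 rewrite h₀ | h₁ = refl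
    next : ∀ c → X (suc m) ≡ c → weight false c ≤ ∑ m (φ (X ∘ suc))
    next false _ = z≤n
    next true  h = L≤∑φ (X ∘ suc) m ≤-refl h

  -- Only the first `suc m` terms change: the first `m` of them vanish and the last becomes
  -- `weight false (X (suc m))`. So a drop can be checked on this window alone.
  ∑φ-drop : ∀ {N} D X X′ → suc m ≤ N →
            (∀ k → k < m → X′ (suc k) ≡ false) →
            (∀ k → m ≤ k → k < N → X′ (suc k) ≡ X (suc k)) →
            D + weight false (X (suc m)) ≤ ∑ (suc m) (φ X) →
            D + ∑ N (φ X′) ≤ ∑ N (φ X)
  ∑φ-drop {N} D X X′ m<N cleared kept drop with m≤n⇒∃[o]m+o≡n m<N
  ... | R , refl = begin
    D + ∑ (suc m + R) (φ X′)                                 ≡⟨ cong (D +_) (∑-++ (suc m) R (φ X′)) ⟩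
    D + (∑ m (φ X′) + φ X′ m + rest X′)                     ≡⟨ cong (D +_) (cong₂ _+_ (cong₂ _+_ φ≡0 φ-last) rest≡) ⟩
    D + (weight false (X (suc m)) + rest X)                  ≡⟨ +-assoc D _ _ ⟨
    D + weight false (X (suc m)) + rest X                    ≤⟨ +-monoˡ-≤ (rest X) drop ⟩
    ∑ (suc m) (φ X) + rest X                                 ≡⟨ ∑-++ (suc m) R (φ X) ⟨
    ∑ (suc m + R) (φ X)                                      ∎
    where
    open ≤-Reasoning
    rest : (ℕ → Bool) → ℕ
    rest Y = ∑ R (λ k → φ Y (suc m + k))
    φ≡0 : ∑ m (φ X′) ≡ 0
    φ≡0 = trans (∑-cong m (λ k k<m → cong (weight (X′ k)) (cleared k k<m)))
                (trans (∑-const m 0) (*-zeroʳ m))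
    φ-last : φ X′ m ≡ weight false (X (suc m))
    φ-last = cong₂ weight (cleared (2 * n) ≤-refl) (kept m ≤-refl m<N)
    rest≡ : rest X′ ≡ rest X
    rest≡ = ∑-cong R λ k k<R → cong₂ weight
      (kept (m + k) (m≤m+n m k) (m<n⇒m<1+n (+-monoʳ-< m k<R)))
      (kept (suc m + k) (≤-trans (n≤1+n m) (m≤m+n (suc m) k)) (+-monoʳ-< (suc m) k<R))

  rise : ∀ (X : ℕ → Bool) d t → X d ≡ false → X (d + t) ≡ true → ∃ λ k → X k ≡ false × X (suc k) ≡ true
  rise X d zero    hd he = contradiction (trans (sym hd) (trans (cong X (sym (+-identityʳ d))) he)) λ ()
  rise X d (suc t) hd he with X (suc d) in eq
  ... | true  = d , hd , eq
  ... | false = rise X (suc d) t eq (trans (cong X (sym (+-suc d t))) he)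

-- Bounds on the game value from the options of the player to move.

module Play (G : Graph) where
  open Graph G
  open ZDomination G

  private variable
    v : Vertex
    j : ℕ

  -- Only vertices are compared, as the legality proof stored in the list need not be the given one.
  legal⇒listed : ∀ h {v} → Legal h v → Any (λ (w , _) → w ≡ v) (legalMoves h)
  legal⇒listed h {v} legal =
    Any.mapMaybe⁺ _ _ (Any.map⁺ (Any.map (λ { refl → found (nonempty? (N v ─ dominated h)) }) (∈-allFin v)))
    where
    found : (d : Dec (Legal h v)) → MAny.Any (λ (w , _) → w ≡ v) (Maybe.map (v ,_) (dec⇒maybe d))
    found (yes _) = MAny.just refl
    found (no ¬l) = contradiction legal ¬l

  -- The bound on the next position is asked for every accessibility proof, because the one passed
  -- down depends on the legality proof found in the list.
  dominator-≤ : ∀ h (a : Acc _<_ (undominated h)) → Legal h v →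
                (∀ a → movesLeft staller (v ∷ h) a ≤ j) → movesLeft dominator h a ≤ suc j
  dominator-≤ h (acc rs) legal ≤j =
    helper _ (Any.map⁺ (Any.map (λ { {v , l} refl → ≤j (rs (legal-decreases h v l)) }) (legal⇒listed h legal)))
    where
    helper : ∀ {j} ks → Any (_≤ j) ks → optimal dominator ks ≤ suc j
    helper (k ∷ ks) (here k≤j)  = s≤s (min≤v⁺ k ks (inj₁ k≤j))
    helper (k ∷ ks) (there any) = s≤s (min≤v⁺ k ks (inj₂ any))

  staller-≥ : ∀ h (a : Acc _<_ (undominated h)) → Legal h v →
              (∀ a → j ≤ movesLeft dominator (v ∷ h) a) → suc j ≤ movesLeft staller h a
  staller-≥ h (acc rs) legal j≤ =
    helper _ (Any.map⁺ (Any.map (λ { {v , l} refl → j≤ (rs (legal-decreases h v l)) }) (legal⇒listed h legal)))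
    where
    helper : ∀ {j} ks → Any (j ≤_) ks → suc j ≤ optimal staller ks
    helper (k ∷ ks) (here j≤k)  = s≤s (v≤max⁺ k ks (inj₁ j≤k))
    helper (k ∷ ks) (there any) = s≤s (v≤max⁺ k ks (inj₂ any))

  staller-≤ : ∀ h (a : Acc _<_ (undominated h)) →
              (∀ v a → Legal h v → movesLeft dominator (v ∷ h) a ≤ j) → movesLeft staller h a ≤ suc j
  staller-≤ h (acc rs) ≤j =
    helper _ (All.map⁺ (All.universal (λ (v , l) → ≤j v (rs (legal-decreases h v l)) l) (legalMoves h)))
    where
    helper : ∀ {j} ks → All (_≤ j) ks → optimal staller ks ≤ suc j
    helper []       []            = z≤n
    helper (k ∷ ks) (k≤j ∷ ks≤j) = s≤s (max≤v⁺ k≤j ks≤j)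

  -- The legal move `v` rules out an empty list of options, whose value would be 0.
  dominator-≥ : ∀ h (a : Acc _<_ (undominated h)) → Legal h v →
                (∀ w a → Legal h w → j ≤ movesLeft staller (w ∷ h) a) → suc j ≤ movesLeft dominator h a
  dominator-≥ h (acc rs) legal j≤ =
    helper _ (Any.map⁺ (Any.map _ (legal⇒listed h legal)))
             (All.map⁺ (All.universal (λ (w , l) → j≤ w (rs (legal-decreases h w l)) l) (legalMoves h)))
    where
    helper : ∀ {j} ks → Any (λ _ → ⊤) ks → All (j ≤_) ks → suc j ≤ optimal dominator ks
    helper (k ∷ ks) _ (j≤k ∷ j≤ks) = s≤s (v≤min⁺ j≤k j≤ks)

  no-legal⇒0 : ∀ p h (a : Acc _<_ (undominated h)) → (∀ v → ¬ Legal h v) → movesLeft p h a ≡ 0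
  no-legal⇒0 p h (acc rs) none with legalMoves h
  ... | []          = opt0 p
    where
    opt0 : ∀ p → optimal p [] ≡ 0
    opt0 dominator = refl
    opt0 staller   = refl
  ... | (v , l) ∷ _ = contradiction l (none v)

-- Neighbourhoods in a graph power in terms of walks.

∈-tabulate⁺ : ∀ {s} {P : Fin s → Set} (P? : ∀ x → Dec (P x)) {x} → P x → x ∈ tabulate (λ y → does (P? y))
∈-tabulate⁺ P? {x} px = lookup⇒[]= x _ (trans (lookup∘tabulate _ x) (dec-true (P? x) px))

∈-tabulate⁻ : ∀ {s} {P : Fin s → Set} (P? : ∀ x → Dec (P x)) {x} → x ∈ tabulate (λ y → does (P? y)) → P x
∈-tabulate⁻ P? {x} x∈ with P? x | trans (sym (lookup∘tabulate (λ y → does (P? y)) x)) ([]=⇒lookup x∈)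
... | yes px | _  = px
... | no _   | ()

module GeodesicPower (n : ℕ) (G : Graph) where
  open Graph G
  open Distance G
  open ZDomination (power n G) using () renaming (N to Nbr; N[_] to Nbr[_])

  -- A shorter walk is taken as long as there is one; where the descent stops, the walk is a
  -- shortest one.
  walk⇒distance : ∀ {u v} j → Acc _<_ j → Walk j u v → ∃ λ d → d ≤ j × IsDistance u v d
  walk⇒distance {u} {v} j (acc rs) p with anyUpTo? (λ k → walk? k u v) j
  ... | no none           = j , ≤-refl , p , λ k<j q → none (_ , k<j , q)
  ... | yes (k , k<j , q) with walk⇒distance k (rs k<j) q
  ...   | d , d≤k , isD = d , ≤-trans d≤k (<⇒≤ k<j) , isD

  walk⇒neighbour : ∀ {u v j} → j ≤ n → Walk j v u → v ≢ u → u ∈ Nbr v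
  walk⇒neighbour j≤n p v≢u with walk⇒distance _ (<-wellFounded _) p
  ... | d , d≤j , isD = ∈-tabulate⁺ (Graph.adj? (power n G) _) (v≢u , d , ≤-trans d≤j j≤n , isD)

  walk⇒closed : ∀ {u v j} → j ≤ n → Walk j v u → u ∈ Nbr[ v ]
  walk⇒closed {u} {v} j≤n p with v ≟ᶠ u
  ... | yes refl = x∈p∪q⁺ (inj₂ (x∈⁅x⁆ v))
  ... | no  v≢u  = x∈p∪q⁺ (inj₁ (walk⇒neighbour j≤n p v≢u))

  closed⇒walk : ∀ {u} v → u ∈ Nbr[ v ] → ∃ λ j → j ≤ n × Walk j v u
  closed⇒walk v u∈ with x∈p∪q⁻ (Nbr v) ⁅ v ⁆ u∈
  ... | inj₂ u∈⁅v⁆ rewrite x∈⁅y⁆⇒x≡y v u∈⁅v⁆ = 0 , z≤n , []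
  ... | inj₁ u∈N with ∈-tabulate⁻ (Graph.adj? (power n G) v) u∈N
  ...   | _ , d , d≤n , p , _ = d , d≤n , p

-- Vertices of the cycle as residues modulo `N`.

module Residues (N : ℕ) .{{_ : NonZero N}} where

  -- Naming vertices by all naturals lets a window of consecutive vertices cross 0 without case
  -- distinctions.
  ι : ℕ → Fin N
  ι k = fromℕ< (m%n<n k N)

  toℕ-ι : ∀ k → toℕ (ι k) ≡ k % N
  toℕ-ι k = toℕ-fromℕ< (m%n<n k N)

  ι-cong-% : ∀ {a b} → a % N ≡ b % N → ι a ≡ ι b
  ι-cong-% {a} {b} eq = toℕ-injective (trans (toℕ-ι a) (trans eq (sym (toℕ-ι b))))

  ι-toℕ : ∀ v → ι (toℕ v) ≡ v
  ι-toℕ v = toℕ-injective (trans (toℕ-ι _) (m<n⇒m%n≡m (toℕ<n v)))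

  ι-periodic : ∀ k → ι (N + k) ≡ ι k
  ι-periodic k = ι-cong-% (trans (cong (_% N) (+-comm N k)) ([m+n]%n≡m%n k N))

  ι-+* : ∀ v c → ι (toℕ v + c * N) ≡ v
  ι-+* v c = trans (ι-cong-% ([m+kn]%n≡m%n (toℕ v) c N)) (ι-toℕ v)

  suc-% : ∀ a b → a % N ≡ b % N → suc a % N ≡ suc b % N
  suc-% a b eq = trans (%-distribˡ-+ 1 a N) (trans (cong (λ z → (1 % N + z) % N) eq) (sym (%-distribˡ-+ 1 b N)))

  -- Adding `pred N` more to both sides completes a full turn, which leaves the residues of `a` and
  -- `b`.
  suc-%-cancel : ∀ a b → suc a % N ≡ suc b % N → a % N ≡ b % N
  suc-%-cancel a b eq = trans (sym (wrap a)) (trans (shift (pred N)) (wrap b))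
    where
    shift : ∀ t → (t + suc a) % N ≡ (t + suc b) % N
    shift zero    = eq
    shift (suc t) = suc-% (t + suc a) (t + suc b) (shift t)
    wrap : ∀ c → (pred N + suc c) % N ≡ c % N
    wrap c = trans (cong (_% N) (trans (+-suc (pred N) c) (trans (cong (_+ c) (suc-pred N)) (+-comm N c))))
                   ([m+n]%n≡m%n c N)

  ι-suc : ∀ {a b} → ι a ≡ ι b → ι (suc a) ≡ ι (suc b)
  ι-suc {a} {b} eq = ι-cong-% (suc-% a b (trans (sym (toℕ-ι a)) (trans (cong toℕ eq) (toℕ-ι b))))

  ι-distinct : ∀ a {d} → 0 < d → d < N → ι (d + a) ≢ ι a
  ι-distinct a {d} 0<d d<N eq = <-irrefl (sym d≡0) 0<d
    where
    cancel : ∀ a → (d + a) % N ≡ a % N → d % N ≡ 0 % N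
    cancel zero    h = trans (cong (_% N) (sym (+-identityʳ d))) h
    cancel (suc a) h = cancel a (suc-%-cancel (d + a) a (trans (cong (_% N) (sym (+-suc d a))) h))
    d≡0 : d ≡ 0
    d≡0 = trans (sym (m<n⇒m%n≡m d<N))
         (trans (cancel a (trans (sym (toℕ-ι (d + a))) (trans (cong toℕ eq) (toℕ-ι a))))
                (m<n⇒m%n≡m (≤-<-trans z≤n d<N)))

  ι-injective-< : ∀ a {k l} → k < l → l < N → ι (l + a) ≢ ι (k + a)
  ι-injective-< a {k} {l} k<l l<N eq with m≤n⇒∃[o]m+o≡n k<l
  ... | d , refl = ι-distinct (k + a) {suc d} z<s
    (≤-<-trans (s≤s (m≤n+m d k)) l<N)
    (trans (cong (ι ∘ suc) (trans (sym (+-assoc d k a)) (cong (_+ a) (+-comm d k)))) eq)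

  ≥-representative : ∀ v b → ∃ λ a → ι (b + a) ≡ v
  -- Adding `b` full turns to `toℕ v` gives an index of at least `b`, from which `b` can be taken
  -- off.
  ≥-representative v b with m≤n⇒∃[o]m+o≡n (≤-trans (m≤m*n b N) (m≤n+m (b * N) (toℕ v)))
  ... | a , eq = a , trans (cong ι eq) (ι-+* v b)

  succ-ι : ∀ a → Succ N (ι a) (ι (suc a))
  succ-ι a = trans (toℕ-ι (suc a)) (suc-% a (toℕ (ι a)) (sym (trans (cong (_% N) (toℕ-ι a)) (m%n%n≡m%n a N))))

  succ⁻ : ∀ {a j} → Succ N (ι a) j → j ≡ ι (suc a)
  succ⁻ {a} s = toℕ-injective (trans s (sym (succ-ι a)))

  pred⁻ : ∀ {a j} → Succ N j (ι (suc a)) → j ≡ ι a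
  pred⁻ {a} {j} s = trans (sym (ι-toℕ j)) (ι-cong-% (sym (suc-%-cancel a (toℕ j) (trans (sym (toℕ-ι (suc a))) s))))

-- The most vertices dominated by j further moves if each move of Dominator
-- dominates 2n + 1 new vertices and each move of Staller dominates one.
coverage : ℕ → Player → ℕ → ℕ
coverage n _         zero    = 0
coverage n dominator (suc j) = suc (2 * n) + coverage n staller j
coverage n staller   (suc j) = 1 + coverage n dominator j

-- Closed neighbourhoods in the cycle power as windows of `m` consecutive vertices.

module CyclePower (n N : ℕ) (1≤n : 1 ≤ n) (3≤N : 3 ≤ N) where

  instance
    N≢0 : NonZero N
    N≢0 = >-nonZero (≤-trans (s≤s z≤n) 3≤N)

  C : Graph
  C = cycle N 3≤N

  open Residues N
  open Weight n
  open Distance C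
  open GeodesicPower n C
  open ZDomination (power n C) renaming (N to Nbr; N[_] to Nbr[_])
  open Play (power n C)

  m≡1+n+n : m ≡ suc (n + n)
  m≡1+n+n = cong (λ z → suc (n + z)) (+-identityʳ n)

  -- `c` is the offset of `w` from `a`. Each step changes the offset by one, and `j ≤ c` keeps it
  -- from going below 0.
  walk⇒window : ∀ a c {j w u} → j ≤ c → w ≡ ι (c + a) → Walk j w u → ∃ λ k → k ≤ c + j × u ≡ ι (k + a)
  walk⇒window a c _ w≡ [] = c , m≤m+n c 0 , w≡
  walk⇒window a c j<c refl (_∷_ {k = j} (inj₁ s) p)
    with walk⇒window a (suc c) (≤-trans (<⇒≤ j<c) (n≤1+n c)) (succ⁻ s) p
  ... | k , k≤ , u≡ = k , subst (k ≤_) (sym (+-suc c j)) k≤ , u≡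
  walk⇒window a (suc c) (s≤s j≤c) refl (_∷_ {k = j} (inj₂ s) p)
    with walk⇒window a c j≤c (pred⁻ s) p
  ... | k , k≤ , u≡ = k , ≤-trans k≤ (+-mono-≤ (n≤1+n c) (n≤1+n j)) , u≡

  ascent : ∀ t b → Walk t (ι b) (ι (t + b))
  ascent zero    b = []
  ascent (suc t) b = inj₁ (succ-ι b) ∷ subst (λ z → Walk t (ι (suc b)) (ι z)) (+-suc t b) (ascent t (suc b))

  closed⇒window : ∀ a {x} → x ∈ Nbr[ ι (n + a) ] → ∃ λ k → k < m × x ≡ ι (k + a)
  closed⇒window a x∈ with closed⇒walk _ x∈
  ... | j , j≤n , p with walk⇒window a n j≤n refl p
  ...   | k , k≤ , x≡ = k , subst (k <_) (sym m≡1+n+n) (s≤s (≤-trans k≤ (+-monoʳ-≤ n j≤n))) , x≡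

  window⇒closed : ∀ a {k} → k < m → ι (k + a) ∈ Nbr[ ι (n + a) ]
  window⇒closed a {k} k<m with ≤-total k n
  ... | inj₁ k≤n with m≤n⇒∃[o]m+o≡n k≤n
  ...   | t , refl = walk⇒closed (m≤n+m t k)
    (reverse (subst (λ z → Walk t (ι (k + a)) (ι z))
      (trans (sym (+-assoc t k a)) (cong (_+ a) (+-comm t k))) (ascent t (k + a))))
  window⇒closed a {k} k<m | inj₂ n≤k with m≤n⇒∃[o]m+o≡n n≤k
  ...   | t , refl = walk⇒closed (+-cancelˡ-≤ n t n (s≤s⁻¹ (subst (n + t <_) m≡1+n+n k<m)))
    (subst (λ z → Walk t (ι (n + a)) (ι z)) (trans (sym (+-assoc t n a)) (cong (_+ a) (+-comm t n))) (ascent t (n + a)))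

  -- Dominated vertices and legal moves.

  ∈-dominated⁻ : ∀ h {x} → x ∈ dominated h → ∃ λ w → x ∈ Nbr[ w ] × (∀ {y} → y ∈ Nbr[ w ] → y ∈ dominated h)
  ∈-dominated⁻ [] x∈ = contradiction x∈ ∉⊥
  ∈-dominated⁻ (w ∷ h) x∈ with x∈p∪q⁻ Nbr[ w ] (dominated h) x∈
  ... | inj₁ x∈N = w , x∈N , λ y∈ → x∈p∪q⁺ (inj₁ y∈)
  ... | inj₂ x∈D with ∈-dominated⁻ h x∈D
  ...   | u , x∈u , u⊆D = u , x∈u , λ y∈ → x∈p∪q⁺ (inj₂ (u⊆D y∈))

  self-closed : ∀ v → v ∈ Nbr[ v ]
  self-closed v = walk⇒closed z≤n []

  -- Legality asks for a new vertex in the open neighbourhood, whereas windows describe closed ones;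
  -- hence `x ≢ v`.
  legal : ∀ h {v x} → x ∉ dominated h → x ∈ Nbr[ v ] → x ≢ v → Legal h v
  legal h {v} {x} x∉ x∈ x≢v with x∈p∪q⁻ (Nbr v) ⁅ v ⁆ x∈
  ... | inj₁ x∈N = x , x∈p∧x∉q⇒x∈p─q x∈N x∉
  ... | inj₂ x≡v = contradiction (x∈⁅y⁆⇒x≡y v x≡v) x≢v

  legal⁻ : ∀ h v → Legal h v → ∃ λ x → x ∉ dominated h × x ∈ Nbr[ v ]
  legal⁻ h v (x , x∈) = x , x∈p─q⇒x∉q (Nbr v) (dominated h) x∈ , x∈p∪q⁺ (inj₁ (p─q⊆p (Nbr v) (dominated h) x∈))

  adjacent⇒legal : ∀ h {v x} → Graph.Adj C v x → x ∉ dominated h → Legal h v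
  adjacent⇒legal h {v} {x} vx x∉ = x , x∈p∧x∉q⇒x∈p─q
    (walk⇒neighbour 1≤n (vx ∷ []) (λ { refl → Graph.adj-irrefl C vx })) x∉

  undominated⇒legal : ∀ h {x} → x ∉ dominated h → ∃ (Legal h)
  undominated⇒legal h {x} x∉ = ι (suc (toℕ x)) ,
    adjacent⇒legal h (inj₂ (subst (λ z → Succ N z (ι (suc (toℕ x)))) (ι-toℕ x) (succ-ι (toℕ x)))) x∉

  -- Undominated vertices as a periodic sequence, their number `U` and the potential `Φ`.

  X : Position → ℕ → Bool
  X h k = not (lookup (dominated h) (ι k))

  X-false : ∀ h k → ι k ∈ dominated h → X h k ≡ false
  X-false h k k∈ = cong not ([]=⇒lookup k∈)

  X-true : ∀ h k → ι k ∉ dominated h → X h k ≡ true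
  X-true h k k∉ with lookup (dominated h) (ι k) in eq
  ... | true  = contradiction (lookup⇒[]= (ι k) _ eq) k∉
  ... | false = refl

  X-false⁻ : ∀ h k → X h k ≡ false → ι k ∈ dominated h
  X-false⁻ h k eq with lookup (dominated h) (ι k) in eq′
  ... | true = lookup⇒[]= (ι k) _ eq′

  X-true⁻ : ∀ h k → X h k ≡ true → ι k ∉ dominated h
  X-true⁻ h k eq k∈ = contradiction (trans (sym eq) (X-false h k k∈)) λ ()

  X-periodic : ∀ h k → X h (N + k) ≡ X h k
  X-periodic h k = cong (λ z → not (lookup (dominated h) z)) (ι-periodic k)

  X-kept : ∀ h v k → (ι k ∈ Nbr[ v ] → ι k ∈ dominated h) → X (v ∷ h) k ≡ X h k
  X-kept h v k N⇒D with X h k in eq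
  ... | false = X-false (v ∷ h) k (x∈p∪q⁺ (inj₂ (X-false⁻ h k eq)))
  ... | true  = X-true (v ∷ h) k λ k∈ → X-true⁻ h k eq (case-∪ (x∈p∪q⁻ Nbr[ v ] (dominated h) k∈))
    where
    case-∪ : ι k ∈ Nbr[ v ] ⊎ ι k ∈ dominated h → ι k ∈ dominated h
    case-∪ (inj₁ k∈) = N⇒D k∈
    case-∪ (inj₂ k∈) = k∈

  -- Offsets below `N` from `a` name different vertices, so those from `m` on lie outside the window
  -- of the move.
  X-outside : m ≤ N → ∀ h a k → m ≤ k → k < N → X (ι (n + a) ∷ h) (k + a) ≡ X h (k + a)
  X-outside m≤N h a k m≤k k<N = X-kept h _ (k + a) λ k∈ → outside (closed⇒window a k∈)
    where
    outside : ∀ {A : Set} → (∃ λ l → l < m × ι (k + a) ≡ ι (l + a)) → A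
    outside (l , l<m , eq) = contradiction eq (ι-injective-< a (<-≤-trans l<m m≤k) k<N)

  X-inside : ∀ h a k → k < m → X (ι (n + a) ∷ h) (k + a) ≡ false
  X-inside h a k k<m = X-false (_ ∷ h) (k + a) (x∈p∪q⁺ (inj₁ (window⇒closed a k<m)))

  U Φ : Position → ℕ
  U h = ∑ N (λ k → ⟦ X h k ⟧)
  Φ h = ∑ N (φ (X h))

  U-rotate : ∀ h a → ∑ N (λ k → ⟦ X h (k + a) ⟧) ≡ U h
  U-rotate h = ∑-rotate N (λ k → ⟦ X h k ⟧) (λ k → cong ⟦_⟧ (X-periodic h k))

  Φ-rotate : ∀ h a → ∑ N (φ (λ k → X h (k + a))) ≡ Φ h
  Φ-rotate h = ∑-rotate N (φ (X h)) λ k → cong₂ weight (X-periodic h k)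
    (trans (cong (X h) (sym (+-suc N k))) (X-periodic h (suc k)))

  ⟦⟧≤1 : ∀ b → ⟦ b ⟧ ≤ 1
  ⟦⟧≤1 false = z≤n
  ⟦⟧≤1 true  = ≤-refl

  ∑⟦⟧≤ : ∀ L (Y : ℕ → Bool) → ∑ L (λ k → ⟦ Y k ⟧) ≤ L
  ∑⟦⟧≤ L Y = ≤-trans (∑-mono L {g = λ _ → 1} (λ k _ → ⟦⟧≤1 (Y k))) (≤-reflexive (trans (∑-const L 1) (*-identityʳ L)))

  X[]≡true : ∀ k → X [] k ≡ true
  X[]≡true k = X-true [] k ∉⊥

  U[] : U [] ≡ N
  U[] = trans (∑-cong N (λ k _ → cong ⟦_⟧ (X[]≡true k))) (trans (∑-const N 1) (*-identityʳ N))

  Φ[] : Φ [] ≡ N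
  Φ[] = trans (∑-cong N (λ k _ → cong₂ weight (X[]≡true k) (X[]≡true (suc k)))) (trans (∑-const N 1) (*-identityʳ N))

  0<U⇒undominated : ∀ h → 0 < U h → ∃ λ x → x ∉ dominated h
  0<U⇒undominated h 0<U with 0<∑⇒∃ N _ 0<U
  ... | k , 0<X = ι k , λ k∈ → <-irrefl (sym (cong ⟦_⟧ (X-false h k k∈))) 0<X

  dominated-rise : ∀ h {d e} → d ∈ dominated h → e ∉ dominated h → ∃ λ i → X h i ≡ false × X h (suc i) ≡ true
  -- The index `toℕ e + toℕ d * N` names `e` and is at least `toℕ d`, so the search for a rise can
  -- run upwards from `d`.
  dominated-rise h {d} {e} d∈ e∉ with m≤n⇒∃[o]m+o≡n (≤-trans (m≤m*n (toℕ d) N) (m≤n+m (toℕ d * N) (toℕ e)))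
  ... | t , eq = rise (X h) (toℕ d) t
    (X-false h (toℕ d) (subst (_∈ dominated h) (sym (ι-toℕ d)) d∈))
    (trans (cong (X h) eq) (X-true h _ (subst (_∉ dominated h) (sym (ι-+* e (toℕ d))) e∉)))

  -- Lower bound: the decrease of `U` in each move.

  U-move : ∀ h v → U h ≤ m + U (v ∷ h)
  U-move h v with ≤-total m N
  ... | inj₂ N≤m = ≤-trans (∑⟦⟧≤ N (X h)) (m≤n⇒m≤n+o _ N≤m)
  ... | inj₁ m≤N with ≥-representative v n | m≤n⇒∃[o]m+o≡n m≤N
  ...   | a , refl | R , eq = begin
    U h                                   ≡⟨ split h ⟩
    ∑ m (Y h) + rest h                    ≤⟨ +-monoˡ-≤ (rest h) (∑⟦⟧≤ m _) ⟩
    m + rest h                            ≡⟨ cong (m +_) (∑-cong R λ k k<R →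
                                               cong ⟦_⟧ (X-outside m≤N h a (m + k) (m≤m+n m k)
                                                 (subst (m + k <_) eq (+-monoʳ-< m k<R)))) ⟨
    m + rest (v ∷ h)                      ≤⟨ +-monoʳ-≤ m (m≤n+m _ (∑ m (Y (v ∷ h)))) ⟩
    m + (∑ m (Y (v ∷ h)) + rest (v ∷ h))  ≡⟨ cong (m +_) (split (v ∷ h)) ⟨
    m + U (v ∷ h)                         ∎
    where
    open ≤-Reasoning
    Y : Position → ℕ → ℕ
    Y g k = ⟦ X g (k + a) ⟧
    rest : Position → ℕ
    rest g = ∑ R (λ k → Y g (m + k))
    split : ∀ g → U g ≡ ∑ m (Y g) + rest g
    split g = trans (sym (U-rotate g a)) (trans (cong (λ z → ∑ z (Y g)) (sym eq)) (∑-++ m R (Y g)))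

  U-single : ∀ h v i → (∀ {x} → x ∈ Nbr[ v ] → x ∈ dominated h ⊎ x ≡ ι i) → U h ≤ 1 + U (v ∷ h)
  U-single h v i single = begin
    U h                            ≡⟨ split h ⟩
    ∑ 1 (Y h) + rest h             ≤⟨ +-monoˡ-≤ (rest h) (∑⟦⟧≤ 1 (λ k → X h (k + i))) ⟩
    1 + rest h                     ≡⟨ cong suc (∑-cong (pred N) λ k k<N-1 →
                                        cong ⟦_⟧ (X-kept h v (suc k + i) λ k∈ → other k k<N-1 (single k∈))) ⟨
    1 + rest (v ∷ h)               ≤⟨ +-monoʳ-≤ 1 (m≤n+m _ (∑ 1 (Y (v ∷ h)))) ⟩
    1 + (∑ 1 (Y (v ∷ h)) + rest (v ∷ h)) ≡⟨ cong suc (split (v ∷ h)) ⟨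
    1 + U (v ∷ h)                  ∎
    where
    open ≤-Reasoning
    Y : Position → ℕ → ℕ
    Y g k = ⟦ X g (k + i) ⟧
    rest : Position → ℕ
    rest g = ∑ (pred N) (λ k → Y g (suc k))
    split : ∀ g → U g ≡ ∑ 1 (Y g) + rest g
    split g = trans (sym (U-rotate g i)) (trans (cong (λ z → ∑ z (Y g)) (sym (suc-pred N))) (∑-++ 1 (pred N) (Y g)))
    other : ∀ k → k < pred N → ι (suc k + i) ∈ dominated h ⊎ ι (suc k + i) ≡ ι i → ι (suc k + i) ∈ dominated h
    other k k< (inj₁ k∈) = k∈
    other k k< (inj₂ eq) = contradiction eq (ι-distinct i z<s (subst (suc k <_) (suc-pred N) (s≤s k<)))

  U-staller-move : ∀ h i → X h i ≡ false → X h (suc i) ≡ true → ∃ λ v → Legal h v × U h ≤ 1 + U (v ∷ h)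
  U-staller-move h i hi hi+ with ∈-dominated⁻ h (X-false⁻ h i hi)
  ... | w , i∈w , w⊆D with ≥-representative w n
  ...   | a , refl with closed⇒window a i∈w
  ...     | k , k<m , ιi≡ = v
    , legal h end∉ end∈v (λ end≡v → end∉ (subst (_∈ dominated h) (sym end≡v) v∈D))
    , U-single h v (suc i) single
    where
    v = ι (n + suc a)
    end∉ : ι (suc i) ∉ dominated h
    end∉ = X-true⁻ h (suc i) hi+
    end≡ : ι (suc i) ≡ ι (suc k + a)
    end≡ = ι-suc {i} {k + a} ιi≡
    -- The whole window of `w` is dominated, so its vertex `ι i` must be the last one; otherwise
    -- `ι (suc i)` would lie in it too.
    1+k≡m : suc k ≡ m
    1+k≡m with m≤n⇒m<n∨m≡n k<m
    ... | inj₂ eq    = eq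
    ... | inj₁ 1+k<m = contradiction (w⊆D (subst (_∈ Nbr[ w ]) (sym end≡) (window⇒closed a 1+k<m))) end∉
    end∈v : ι (suc i) ∈ Nbr[ v ]
    end∈v = subst (_∈ Nbr[ v ]) (sym (trans end≡ (cong ι (sym (+-suc k a))))) (window⇒closed (suc a) k<m)
    -- As `n ≥ 1`, the successor `v` of `w` lies in `Nbr[ w ]`; being dominated, it differs from the
    -- new vertex `ι (suc i)`, so the move is legal.
    v∈D : v ∈ dominated h
    v∈D = w⊆D (subst (λ z → ι z ∈ Nbr[ w ]) (sym (+-suc n a))
      (window⇒closed a (s≤s (subst (suc n ≤_) (cong (n +_) (sym (+-identityʳ n))) (+-monoˡ-≤ n 1≤n)))))
    single : ∀ {x} → x ∈ Nbr[ v ] → x ∈ dominated h ⊎ x ≡ ι (suc i)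
    single x∈ with closed⇒window (suc a) x∈
    ... | l , l<m , refl with m≤n⇒m<n∨m≡n l<m
    ...   | inj₁ 1+l<m = inj₁ (w⊆D (subst (λ z → ι z ∈ Nbr[ w ]) (sym (+-suc l a)) (window⇒closed a 1+l<m)))
    ...   | inj₂ 1+l≡m = inj₂ (trans (cong ι (trans (+-suc l a) (cong (_+ a) (trans 1+l≡m (sym 1+k≡m))))) (sym end≡))

  -- Each move takes at most its summand of `coverage` off `U`: Dominator's by `U-move`, Staller's
  -- by her choice. So something stays undominated after `j` moves and one more is played. Staller's
  -- choice starts from a rise, hence from a dominated vertex.
  movesLeft-lower : ∀ p j h a → (p ≡ staller → ∃ λ d → d ∈ dominated h) →
                    coverage n p j < U h → suc j ≤ movesLeft p h a
  movesLeft-lower dominator zero h a d 0<U with 0<U⇒undominated h 0<U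
  ... | _ , x∉ = dominator-≥ h a (proj₂ (undominated⇒legal h x∉)) λ _ _ _ → z≤n
  movesLeft-lower dominator (suc j) h a d c<U with 0<U⇒undominated h (≤-<-trans z≤n c<U)
  ... | _ , x∉ = dominator-≥ h a (proj₂ (undominated⇒legal h x∉)) λ v a′ l →
    movesLeft-lower staller j (v ∷ h) a′ (λ _ → v , x∈p∪q⁺ (inj₁ (self-closed v)))
      (+-cancelˡ-< m _ _ (<-≤-trans c<U (U-move h v)))
  movesLeft-lower staller j h a d c<U with 0<U⇒undominated h (≤-<-trans z≤n c<U) | d refl
  ... | _ , x∉ | _ , d∈ with dominated-rise h d∈ x∉
  ...   | i , hi , hi+ with U-staller-move h i hi hi+
  ...     | v , l , U≤ = staller-≥ h a l (after j c<U)
    where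
    after : ∀ j → coverage n staller j < U h → ∀ a′ → j ≤ movesLeft dominator (v ∷ h) a′
    after zero    _   a′ = z≤n
    after (suc j) c<U a′ = movesLeft-lower dominator j (v ∷ h) a′ (λ ()) (+-cancelˡ-< 1 _ _ (<-≤-trans c<U U≤))

  -- Upper bound: the decrease of `Φ` in each move.

  Φ-window-drop : suc m ≤ N → ∀ h a D → D + weight false (X h (suc m + a)) ≤ ∑ (suc m) (φ (λ k → X h (k + a))) →
           D + Φ (ι (n + suc a) ∷ h) ≤ Φ h
  Φ-window-drop m<N h a D drop = subst₂ (λ y z → D + y ≤ z) (Φ-rotate (v ∷ h) a) (Φ-rotate h a)
    (∑φ-drop D (λ k → X h (k + a)) (λ k → X (v ∷ h) (k + a)) m<N cleared kept drop)
    where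
    v = ι (n + suc a)
    cleared : ∀ k → k < m → X (v ∷ h) (suc k + a) ≡ false
    cleared k k<m = trans (cong (X (v ∷ h)) (sym (+-suc k a))) (X-inside h (suc a) k k<m)
    -- The case `k = N - 1` is the vertex `ι a` just before the window, reached by a full turn;
    -- `suc m ≤ N` keeps it outside the window.
    kept : ∀ k → m ≤ k → k < N → X (v ∷ h) (suc k + a) ≡ X h (suc k + a)
    kept k m≤k k<N = subst (λ z → X (v ∷ h) z ≡ X h z) (+-suc k a) (X-outside (<⇒≤ m<N) h (suc a) k m≤k k<N)

  Φ-legal-move : suc m ≤ N → ∀ h v → Legal h v → 1 + Φ (v ∷ h) ≤ Φ h
  -- With `suc n` in place of `n`, the window of `v` begins at `suc a`, and `a` is the index just
  -- before it.
  Φ-legal-move m<N h v l with ≥-representative v (suc n)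
  ... | a , eq rewrite trans (sym eq) (cong ι (sym (+-suc n a))) with legal⁻ h _ l
  ...   | x , x∉ , x∈ with closed⇒window (suc a) x∈
  ...     | k , k<m , refl = Φ-window-drop m<N h a 1 (1+next≤∑φ (λ i → X h (i + a)) k k<m
    (trans (cong (X h) (sym (+-suc k a))) (X-true h (k + suc a) x∉)))

  Φ-dominator-move : suc m ≤ N → ∀ h i → X h i ≡ false → X h (suc i) ≡ true → ∃ λ v → Legal h v × m + Φ (v ∷ h) ≤ Φ h
  Φ-dominator-move m<N h i hi hi+ = ι (n + suc i)
    , legal h (X-true⁻ h (suc i) hi+) (window⇒closed (suc i) z<s) (≢-sym (ι-distinct (suc i) 1≤n n<N))
    , Φ-window-drop m<N h i m (m+next≤∑φ (λ k → X h (k + i)) hi hi+)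
    where
    n<N : n < N
    n<N = ≤-trans (s≤s (m≤m+n n (n + 0))) (<⇒≤ m<N)

  m≤Φ : ∀ h i → X h i ≡ false → X h (suc i) ≡ true → m ≤ Φ h
  m≤Φ h i hi hi+ = subst (m ≤_) (Φ-rotate h i) (≤-trans (≤-reflexive (sym (cong₂ weight hi hi+)))
    (term≤∑ (φ (λ k → X h (k + i))) (≤-trans (s≤s z≤n) 3≤N)))

  all-dominated⇒0 : ∀ p h a → (∀ x → x ∈ dominated h) → movesLeft p h a ≡ 0
  all-dominated⇒0 p h a all = no-legal⇒0 p h a λ v l → let (x , x∉ , _) = legal⁻ h v l in x∉ (all x)

  -- In an unfinished position `Φ` is at least `m`, so the bound with `j = 0` and slack `2 * n` can
  -- hold only once everything is dominated. For larger `j` a move takes at least its summand of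
  -- `coverage` off `Φ`.
  movesLeft-upper : suc m ≤ N → ∀ p j h a → (∃ λ d → d ∈ dominated h) →
                    Φ h ≤ 2 * n + coverage n p j → movesLeft p h a ≤ j
  movesLeft-upper m<N p j h a (d , d∈) Φ≤ with any? (λ x → ¬? (x ∈? dominated h))
  ... | no none = subst (_≤ j) (sym (all-dominated⇒0 p h a all)) z≤n
    where
    all : ∀ x → x ∈ dominated h
    all x with x ∈? dominated h
    ... | yes x∈ = x∈
    ... | no x∉  = contradiction (x , x∉) none
  ... | yes (x , x∉) with dominated-rise h d∈ x∉
  ...   | i , hi , hi+ = go p j Φ≤
    where
    go : ∀ p j → Φ h ≤ 2 * n + coverage n p j → movesLeft p h a ≤ j
    go p zero Φ≤ = contradiction (≤-trans (m≤Φ h i hi hi+) (≤-trans Φ≤ (≤-reflexive (+-identityʳ (2 * n))))) 1+n≰n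
    go dominator (suc j) Φ≤ with Φ-dominator-move m<N h i hi hi+
    ... | v , l , Φ′≤ = dominator-≤ h a l λ a′ → movesLeft-upper m<N staller j (v ∷ h) a′ (v , x∈p∪q⁺ (inj₁ (self-closed v)))
      (+-cancelˡ-≤ m _ _ (≤-trans Φ′≤ (≤-trans Φ≤ (≤-reflexive (+-swap (2 * n) m _)))))
      where
      +-swap : ∀ x y z → x + (y + z) ≡ y + (x + z)
      +-swap x y z = trans (sym (+-assoc x y z)) (trans (cong (_+ z) (+-comm x y)) (+-assoc y x z))
    go staller (suc j) Φ≤ = staller-≤ h a λ v a′ l →
      movesLeft-upper m<N dominator j (v ∷ h) a′ (v , x∈p∪q⁺ (inj₁ (self-closed v)))
        (s≤s⁻¹ (≤-trans (Φ-legal-move m<N h v l) (≤-trans Φ≤ (≤-reflexive (+-suc (2 * n) _)))))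

  -- The value of the game in terms of `coverage`.

  γZg≡ : ∀ j → coverage n dominator j < N → N ≤ coverage n dominator (suc j) → γZg (power n C) ≡ suc j
  γZg≡ j c<N N≤c = ≤-antisym above
    (movesLeft-lower dominator j [] (<-wellFounded _) (λ ()) (subst (coverage n dominator j <_) (sym U[]) c<N))
    where
    v = ι n
    l : Legal [] v
    l = adjacent⇒legal [] (inj₁ (succ-ι n)) ∉⊥
    v∈ : ∃ λ d → d ∈ dominated (v ∷ [])
    v∈ = v , x∈p∪q⁺ (inj₁ (self-closed v))
    above : γZg (power n C) ≤ suc j
    above with ≤-<-connex N m
    -- Here the first move dominates the whole cycle.
    ... | inj₁ N≤m = dominator-≤ [] (<-wellFounded _) l λ a′ →
      subst (_≤ j) (sym (all-dominated⇒0 staller (v ∷ []) a′ all)) z≤n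
      where
      all : ∀ x → x ∈ dominated (v ∷ [])
      all x = x∈p∪q⁺ (inj₁ (subst₂ (λ y z → y ∈ Nbr[ ι z ]) (trans (cong ι (+-identityʳ _)) (ι-toℕ x)) (+-identityʳ n)
        (window⇒closed 0 (<-≤-trans (toℕ<n x) N≤m))))
    -- The first move is only known to lower `Φ` by 1: of its summand `m` in `coverage`, the
    -- remaining `2 * n` become the slack of `movesLeft-upper`.
    ... | inj₂ m<N = dominator-≤ [] (<-wellFounded _) l λ a′ → movesLeft-upper m<N staller j (v ∷ []) a′ v∈
      (s≤s⁻¹ (≤-trans (Φ-legal-move m<N [] v l) (≤-trans (≤-reflexive Φ[]) N≤c)))

-- Ceilings of fractions.

import Data.Integer as ℤ
import Data.Integer.Properties as ℤ
open import Data.Integer using (+_; _-_; -_)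
open import Data.Integer.DivMod using (div-pos-is-/ℕ; [n/ℕd]*d≤n; n<s[n/ℕd]*d)
open import Data.Rational.Unnormalised using (_/_; ceiling)

-- `ceiling` negates the floor of the negation, so the integer quotient of `- + a` is squeezed. The
-- second bound says `c - 1 < a / (d + 1)` without subtraction.
ceiling≡ : ∀ a d c → a ≤ c * suc d → c * suc d < a + suc d → ceiling (+ a / suc d) ≡ + c
ceiling≡ a d c a≤cD cD<a+D = trans (cong -_ floor≡) (ℤ.neg-involutive (+ c))
  where
  D = + suc d
  f = (- + a) ℤ./ℕ suc d
  -cD≤-a : - + c ℤ.* D ℤ.≤ - + a
  -cD≤-a = begin
    - + c ℤ.* D      ≡⟨ ℤ.neg-distribˡ-* (+ c) D ⟨
    - (+ c ℤ.* D)    ≡⟨ cong -_ (ℤ.pos-* c (suc d)) ⟨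
    - + (c * suc d)  ≤⟨ ℤ.neg-mono-≤ (ℤ.+≤+ a≤cD) ⟩
    - + a            ∎
    where open ℤ.≤-Reasoning
  -a<[1-c]D : - + a ℤ.< ℤ.suc (- + c) ℤ.* D
  -a<[1-c]D = begin-strict
    - + a                              ≡⟨ ℤ.+-identityˡ _ ⟨
    + 0 ℤ.+ - + a                      ≡⟨ cong (ℤ._+ - + a) (ℤ.+-inverseˡ (+ (c * suc d))) ⟨
    - + (c * suc d) ℤ.+ + (c * suc d) ℤ.+ - + a
      ≡⟨ ℤ.+-assoc (- + (c * suc d)) (+ (c * suc d)) (- + a) ⟩
    - + (c * suc d) ℤ.+ (+ (c * suc d) ℤ.+ - + a)
      <⟨ ℤ.+-monoʳ-< (- + (c * suc d)) (ℤ.+-monoˡ-< (- + a) (ℤ.+<+ cD<a+D)) ⟩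
    - + (c * suc d) ℤ.+ (+ (a + suc d) ℤ.+ - + a)
      ≡⟨ cong (λ z → - + (c * suc d) ℤ.+ z) a+D-a ⟩
    - + (c * suc d) ℤ.+ D              ≡⟨ ℤ.+-comm (- + (c * suc d)) D ⟩
    D ℤ.+ - + (c * suc d)              ≡⟨ cong (λ z → D ℤ.+ z)
                                             (trans (cong -_ (ℤ.pos-* c (suc d))) (ℤ.neg-distribˡ-* (+ c) D)) ⟩
    D ℤ.+ - + c ℤ.* D                  ≡⟨ ℤ.suc-* (- + c) D ⟨
    ℤ.suc (- + c) ℤ.* D                ∎
    where
    open ℤ.≤-Reasoning
    a+D-a : + (a + suc d) ℤ.+ - + a ≡ D
    a+D-a = trans (cong (λ z → + z ℤ.+ - + a) (+-comm a (suc d)))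
            (trans (ℤ.+-assoc D (+ a) (- + a)) (trans (cong (λ z → D ℤ.+ z) (ℤ.+-inverseʳ (+ a))) (ℤ.+-identityʳ D)))
  -- Used twice, with the quotient and `- + c` exchanging roles, for the two inequalities.
  *D-cancel-≤ : ∀ {i j k} → i ℤ.* D ℤ.≤ j → j ℤ.< ℤ.suc k ℤ.* D → i ℤ.≤ k
  *D-cancel-≤ {i} {k = k} iD≤j j<sD = subst (i ℤ.≤_) (ℤ.pred-suc k)
    (ℤ.i<j⇒i≤pred[j] (ℤ.*-cancelʳ-<-nonNeg {i} {ℤ.suc k} D (ℤ.≤-<-trans iD≤j j<sD)))
  floor≡ : (- + a) ℤ./ D ≡ - + c
  floor≡ = trans (div-pos-is-/ℕ (- + a) (suc d)) (ℤ.≤-antisym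
    (*D-cancel-≤ ([n/ℕd]*d≤n (- + a) (suc d)) -a<[1-c]D)
    (*D-cancel-≤ -cD≤-a (n<s[n/ℕd]*d (- + a) (suc d))))

-- Rounds of two moves, each covering `2 + 2 * n`, and the cases of the remainder.

coverage-rounds : ∀ n p q → coverage n p (q * 2) ≡ q * (2 + 2 * n)
coverage-rounds n p zero = refl
coverage-rounds n dominator (suc q) =
  trans (cong (λ c → suc (2 * n) + suc c) (coverage-rounds n dominator q)) (+-suc (suc (2 * n)) _)
coverage-rounds n staller (suc q) = cong (λ c → 2 + 2 * n + c) (coverage-rounds n staller q)

module _ (n N : ℕ) (1≤n : 1 ≤ n) (3≤N : 3 ≤ N) where
  open CyclePower n N 1≤n 3≤N using (γZg≡)

  γZg-exact : ∀ q → N ≡ q * (2 + 2 * n) → γZg (power n (cycle N 3≤N)) ≡ q * 2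
  γZg-exact zero    N≡ = contradiction (subst (3 ≤_) N≡ 3≤N) λ ()
  -- All moves but the last cover `N - 1` vertices, so Staller's move completing the last round is
  -- still needed.
  γZg-exact (suc q) N≡ = γZg≡ (suc (q * 2))
    (≤-reflexive (trans (cong (λ c → 2 + 2 * n + c) (coverage-rounds n staller q)) (sym N≡)))
    (≤-reflexive (trans N≡ (sym (coverage-rounds n dominator (suc q)))))

  -- The `q` rounds fall short of `N` since `0 < r`, and one further move of Dominator covers
  -- `2 * n + 1`, hence the `r` left over.
  γZg-remainder : ∀ r q → 0 < r → r < 2 + 2 * n → N ≡ r + q * (2 + 2 * n) →
                  γZg (power n (cycle N 3≤N)) ≡ suc (q * 2)
  γZg-remainder r q 0<r r<M N≡ = γZg≡ (q * 2)
    (subst₂ _<_ (sym (coverage-rounds n dominator q)) (sym N≡) (+-monoˡ-≤ (q * (2 + 2 * n)) 0<r))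
    (subst₂ _≤_ (sym N≡) (cong (λ z → suc (2 * n) + z) (sym (coverage-rounds n staller q)))
      (+-monoˡ-≤ (q * (2 + 2 * n)) (≤-pred r<M)))

corollary4p4 : (n N : ℕ) → 1 ≤ n → (3≤N : 3 ≤ N) →
    (N % (2 + 2 * n) ≤ suc n →
    + γZg (power n (cycle N 3≤N)) ≡ ceiling (+ N / suc n))
    × (2 + n ≤ N % (2 + 2 * n) →
    + γZg (power n (cycle N 3≤N)) ≡ ceiling (+ N / suc n) - + 1)
corollary4p4 n N 1≤n 3≤N = small , large
  where
  M = 2 + 2 * n
  r = N % M
  q = N ℕ./ M
  N≡ : N ≡ r + q * M
  N≡ = m≡m%n+[m/n]*n N M
  2*D≡M : suc n + suc n ≡ M
  2*D≡M = trans (cong (λ z → suc n + z) (sym (+-identityʳ (suc n)))) (*-suc 2 n)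
  2q*D≡qM : q * 2 * suc n ≡ q * M
  2q*D≡qM = trans (*-assoc q 2 (suc n)) (cong (q *_) (*-suc 2 n))

  small : r ≤ suc n → + γZg (power n (cycle N 3≤N)) ≡ ceiling (+ N / suc n)
  small r≤D with m≤n⇒m<n∨m≡n (z≤n {r})
  ... | inj₂ 0≡r = trans (cong +_ (γZg-exact n N 1≤n 3≤N q N≡qM)) (sym (ceiling≡ N n (q * 2)
      (≤-reflexive (sym 2q*D≡N)) (≤-<-trans (≤-reflexive 2q*D≡N) (m<m+n N z<s))))
    where
    N≡qM : N ≡ q * M
    N≡qM = trans N≡ (cong (_+ q * M) (sym 0≡r))
    2q*D≡N : q * 2 * suc n ≡ N
    2q*D≡N = trans 2q*D≡qM (sym N≡qM)
  -- With `0 < r ≤ n + 1` the fraction lies above `2q` and is at most `2q + 1`.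
  ... | inj₁ 0<r = trans (cong +_ (γZg-remainder n N 1≤n 3≤N r q 0<r (m%n<n N M) N≡)) (sym (ceiling≡ N n (suc (q * 2))
      (begin
        N                      ≡⟨ N≡ ⟩
        r + q * M              ≤⟨ +-monoˡ-≤ (q * M) r≤D ⟩
        suc n + q * M          ≡⟨ cong (λ z → suc n + z) 2q*D≡qM ⟨
        suc n + q * 2 * suc n  ∎)
      (begin-strict
        suc n + q * 2 * suc n  ≡⟨ cong (λ z → suc n + z) 2q*D≡qM ⟩
        suc n + q * M          <⟨ +-monoʳ-< (suc n) (m<n+m (q * M) 0<r) ⟩
        suc n + (r + q * M)    ≡⟨ cong (λ z → suc n + z) N≡ ⟨
        suc n + N              ≡⟨ +-comm (suc n) N ⟩
        N + suc n              ∎)))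
    where open ≤-Reasoning

  large : 2 + n ≤ r → + γZg (power n (cycle N 3≤N)) ≡ ceiling (+ N / suc n) - + 1
  -- With `r > n + 1` the fraction exceeds `2q + 1`, so its ceiling is `2q + 2`; one move of
  -- Dominator after the `q` rounds still covers all `r` vertices, which accounts for the difference
  -- of 1.
  large D<r = trans (cong +_ (γZg-remainder n N 1≤n 3≤N r q (<-trans z<s D<r) (m%n<n N M) N≡))
    (cong (_- + 1) (sym (ceiling≡ N n (2 + q * 2)
      (begin
        N                                ≡⟨ N≡ ⟩
        r + q * M                        ≤⟨ +-monoˡ-≤ (q * M) (<⇒≤ (m%n<n N M)) ⟩
        M + q * M                        ≡⟨ cong (_+ q * M) 2*D≡M ⟨
        suc n + suc n + q * M            ≡⟨ +-assoc (suc n) (suc n) (q * M) ⟩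
        suc n + (suc n + q * M)          ≡⟨ cong (λ z → suc n + (suc n + z)) 2q*D≡qM ⟨
        suc n + (suc n + q * 2 * suc n)  ∎)
      (begin-strict
        suc n + (suc n + q * 2 * suc n)  ≡⟨ cong (λ z → suc n + (suc n + z)) 2q*D≡qM ⟩
        suc n + (suc n + q * M)          <⟨ +-monoʳ-< (suc n) (+-monoˡ-< (q * M) D<r) ⟩
        suc n + (r + q * M)              ≡⟨ cong (λ z → suc n + z) N≡ ⟨
        suc n + N                        ≡⟨ +-comm (suc n) N ⟩
        N + suc n                        ∎))))
    where open ≤-Reasoning
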